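{- Let $k\ge 0$. If $\mathcal{M}$ is a matroid whose base configuration $V_{\mathcal{M}}$ has Theta rank at most $k$, then every minor $\mathcal{N}$ of $\mathcal{M}$ has base configuration of Theta rank at most $k$. Likewise, if $V_{\mathcal{M}}$ has levelness at most $k$, then so does $V_{\mathcal{N}}$ for every minor $\mathcal{N}$ of $\mathcal{M}$.
   Context: For a matroid $\mathcal{M}=(E,\mathcal{B})$ with set of bases $\mathcal{B}$, the base configuration is $V_{\mathcal{M}}=\{\mathbf{1}_B:B\in\mathcal{B}\}\subset\mathbb{R}^E$ ($\mathbf{1}_B$ the characteristic vector). Minors are obtained by sequences of deletions and contractions (deleting a coloop $e$ gives bases $\{B\setminus e\}$; contracting a loop is defined dually). A point configuration is a finite set $V\subset\mathbb{R}^n$; a linear function means an affine function. A linear function $\ell$ nonnegative on $V$ is $k$-sos with respect to $V$ if $\ell(v)=\sum_i h_i(v)^2$ for all $v\in V$ for some polynomials $h_i$ of degree $\le k$. The Theta rank of $V$ is the smallest $k\ge 0$ such that every linear function nonnegative on $V$ is $k$-sos. For $\ell$ nonnegative on $V$, $\{v\in V:\ell(v)=0\}$ is a face; inclusion-maximal faces different from $V$ are facets and the corresponding $\ell$ facet-defining. The levelness of $V$ is the smallest $k$ such that every facet-defining linear function takes at most $k$ distinct values on $V$. -}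

module Defs where

open import Algebra.Bundles using (CommutativeRing; Semiring)
open import Data.Fin.Base using (Fin)
open import Data.Fin.Subset using (Subset; Side; inside; outside; _∈_; _∉_; _∪_; _-_; ⁅_⁆)
open import Data.List.Base as List using (List; []; _∷_; _++_; length)
open import Data.List.Membership.Propositional using () renaming (_∈_ to _∈ᴸ_)
open import Data.List.Membership.Propositional.Properties using (∈-map⁺; ∈-++⁺ˡ; ∈-++⁺ʳ)
open import Data.List.Relation.Unary.All using (All)
open import Data.List.Relation.Unary.Any as Any using (Any; here)
import Data.List.Relation.Unary.Any.Properties as Anyₚ
open import Data.Nat.Base as ℕ using (ℕ; zero; suc)
open import Data.Product.Base using (∃; _×_; _,_)
open import Data.Sum.Base using (_⊎_)
open import Data.Bool.Base using (if_then_else_)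
open import Data.Vec.Base as Vec using ([]; _∷_; lookup; removeAt)
open import Data.Vec.Functional as Vector using (Vector)
open import Data.Vec.Functional.Relation.Binary.Pointwise using (Pointwise)
open import Function.Bundles using (_⇔_)
open import Level using (Level; 0ℓ; _⊔_) renaming (suc to lsuc)
open import Relation.Binary.Core using (Rel)
open import Relation.Binary.PropositionalEquality.Core using (_≡_; refl; subst)
open import Relation.Binary.Structures using (IsTotalOrder)
open import Relation.Nullary using (¬_)
open import Relation.Unary using (Pred; _⊆_; _≐_)

------------------------------------------------------------------------
-- Matroids on the ground set Fin n, and their minors

record Matroid (n : ℕ) : Set₁ where
  field
    Basis    : Pred (Subset n) 0ℓ
    nonempty : ∃ Basis
    exchange : ∀ {B₁ B₂} → Basis B₁ → Basis B₂ →
               ∀ x → x ∈ B₁ → x ∉ B₂ →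
               ∃ λ y → y ∈ B₂ × y ∉ B₁ × Basis ((B₁ - x) ∪ ⁅ y ⁆)

module _ {n : ℕ} (M : Matroid n) where
  open Matroid M

  Loop : Pred (Fin n) 0ℓ
  Loop e = ∀ B → Basis B → e ∉ B

  Coloop : Pred (Fin n) 0ℓ
  Coloop e = ∀ B → Basis B → e ∈ B

-- The ground set E ∖ {e} is identified with Fin n through `punchIn e`.
-- Under this identification, `removeAt B e` is B ∖ {e}, for every
-- subset B of Fin (suc n).

module _ {n : ℕ} (M : Matroid (suc n)) (e : Fin (suc n)) where
  open Matroid M

  DeletionBasis : Pred (Subset n) 0ℓ
  DeletionBasis B =
      (¬ Coloop M e × ∃ λ B′ → Basis B′ × e ∉ B′ × removeAt B′ e ≡ B)
    ⊎ (Coloop M e × ∃ λ B′ → Basis B′ × removeAt B′ e ≡ B)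

  ContractionBasis : Pred (Subset n) 0ℓ
  ContractionBasis B =
      (¬ Loop M e × ∃ λ B′ → Basis B′ × e ∈ B′ × removeAt B′ e ≡ B)
    ⊎ (Loop M e × ∃ λ B′ → Basis B′ × removeAt B′ e ≡ B)

-- Matroids are compared by their sets of bases.

infix 4 _HasBases_ _IsMinorOf_

_HasBases_ : ∀ {n} → Matroid n → Pred (Subset n) 0ℓ → Set
N HasBases P = ∀ B → Matroid.Basis N B ⇔ P B

data _IsMinorOf_ {m} (N : Matroid m) : ∀ {n} → Matroid n → Set₁ where
  equal       : ∀ {M : Matroid m} → N HasBases Matroid.Basis M →
                N IsMinorOf M
  deletion    : ∀ {n} {M : Matroid (suc n)} {M′ : Matroid n} e →
                M′ HasBases DeletionBasis M e →
                N IsMinorOf M′ → N IsMinorOf M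
  contraction : ∀ {n} {M : Matroid (suc n)} {M′ : Matroid n} e →
                M′ HasBases ContractionBasis M e →
                N IsMinorOf M′ → N IsMinorOf M

subsets : ∀ n → List (Subset n)
subsets zero    = [] ∷ []
subsets (suc n) = List.map (inside ∷_) (subsets n)
               ++ List.map (outside ∷_) (subsets n)

∈-subsets : ∀ {n} (B : Subset n) → B ∈ᴸ subsets n
∈-subsets []            = here refl
∈-subsets (inside ∷ B)  = ∈-++⁺ˡ (∈-map⁺ (inside ∷_) (∈-subsets B))
∈-subsets (outside ∷ B) =
  ∈-++⁺ʳ (List.map (inside ∷_) (subsets _)) (∈-map⁺ (outside ∷_) (∈-subsets B))

------------------------------------------------------------------------
-- The real numbers
--
-- The library has no type of real numbers; they are characterised,
-- classically and up to unique isomorphism, as a complete ordered field.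

record CompleteOrderedField (c ℓ : Level) : Set (lsuc (c ⊔ ℓ)) where
  infix 4 _≤_
  field
    commutativeRing : CommutativeRing c ℓ
  open CommutativeRing commutativeRing public
  field
    _≤_          : Rel Carrier ℓ
    isTotalOrder : IsTotalOrder _≈_ _≤_
    0≉1          : ¬ 0# ≈ 1#
    inverse      : ∀ x → ¬ x ≈ 0# → ∃ λ y → x * y ≈ 1#
    +-monoˡ-≤    : ∀ {x y} z → x ≤ y → x + z ≤ y + z
    *-nonNeg     : ∀ {x y} → 0# ≤ x → 0# ≤ y → 0# ≤ x * y

  UpperBound : Pred Carrier ℓ → Pred Carrier (c ⊔ ℓ)
  UpperBound S u = ∀ x → S x → x ≤ u

  field
    supremum : (S : Pred Carrier ℓ) → ∃ S → ∃ (UpperBound S) →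
               ∃ λ s → UpperBound S s × (∀ u → UpperBound S u → s ≤ u)

------------------------------------------------------------------------

IsSmallest : ∀ {a} → Pred ℕ a → Pred ℕ a
IsSmallest P k = P k × (∀ j → P j → k ℕ.≤ j)

module PointConfigurations {c ℓ} (ℝ : CompleteOrderedField c ℓ) where

  open CompleteOrderedField ℝ hiding (zero; refl)
  open import Algebra.Definitions.RawSemiring
    (Semiring.rawSemiring semiring) using (sum; product; _^_)

  Point : ℕ → Set c
  Point = Vector Carrier

  infix 4 _≋_

  _≋_ : ∀ {n} → Rel (Point n) ℓ
  _≋_ = Pointwise _≈_

  record PointConfiguration (n : ℕ) : Set (c ⊔ lsuc ℓ) where
    field
      Member  : Pred (Point n) ℓ
      respect : ∀ {v w} → v ≋ w → Member v → Member w
      finite  : ∃ λ (vs : List (Point n)) → ∀ v → Member v → Any (v ≋_) vs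

  open PointConfiguration public

  -- A linear function in the affine sense: x ↦ constant + Σᵢ slopeᵢ xᵢ.

  record Linear (n : ℕ) : Set c where
    constructor linear
    field
      constant : Carrier
      slope    : Vector Carrier n

  ⟦_⟧ : ∀ {n} → Linear n → Point n → Carrier
  ⟦ linear a b ⟧ v = a + sum (λ i → b i * v i)

  NonNegativeOn : ∀ {n} → PointConfiguration n → Pred (Linear n) (c ⊔ ℓ)
  NonNegativeOn V l = ∀ v → Member V v → 0# ≤ ⟦ l ⟧ v

  -- A polynomial is a formal finite sum of terms coefficient · x^exponents.
  -- Terms may be repeated or have coefficient zero, so `DegreeAtMost k`
  -- bounds the degree of a presentation; a polynomial has degree at most k
  -- exactly when some presentation of it satisfies this bound.

  record Term (n : ℕ) : Set c where
    constructor term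
    field
      coefficient : Carrier
      exponents   : Vector ℕ n

    degree : ℕ
    degree = Vector.foldr ℕ._+_ 0 exponents

    evaluate : Point n → Carrier
    evaluate v = coefficient * product (λ i → v i ^ exponents i)

  Polynomial : ℕ → Set c
  Polynomial n = List (Term n)

  DegreeAtMost : ∀ {n} → ℕ → Pred (Polynomial n) c
  DegreeAtMost k = All (λ t → Term.degree t ℕ.≤ k)

  sumᴸ : List Carrier → Carrier
  sumᴸ = List.foldr _+_ 0#

  evaluate : ∀ {n} → Polynomial n → Point n → Carrier
  evaluate h v = sumᴸ (List.map (λ t → Term.evaluate t v) h)

  IsSOS : ∀ {n} → PointConfiguration n → ℕ → Pred (Linear n) (c ⊔ ℓ)
  IsSOS {n} V k l = ∃ λ (hs : List (Polynomial n)) →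
    All (DegreeAtMost k) hs ×
    (∀ v → Member V v → ⟦ l ⟧ v ≈ sumᴸ (List.map (λ h → evaluate h v ^ 2) hs))

  IsThetaRank : ∀ {n} → PointConfiguration n → Pred ℕ (c ⊔ ℓ)
  IsThetaRank V = IsSmallest λ k → ∀ l → NonNegativeOn V l → IsSOS V k l

  ThetaRankAtMost : ∀ {n} → PointConfiguration n → Pred ℕ (c ⊔ ℓ)
  ThetaRankAtMost V k = ∃ λ r → IsThetaRank V r × r ℕ.≤ k

  ZeroSet : ∀ {n} → PointConfiguration n → Linear n → Pred (Point n) ℓ
  ZeroSet V l v = Member V v × ⟦ l ⟧ v ≈ 0#

  IsFace : ∀ {n} → PointConfiguration n → Pred (Pred (Point n) ℓ) (c ⊔ ℓ)
  IsFace V F = ∃ λ l → NonNegativeOn V l × F ≐ ZeroSet V l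

  -- The empty set is a face, hence a facet when V is a single point.

  IsFacet : ∀ {n} → PointConfiguration n → Pred (Pred (Point n) ℓ) (c ⊔ lsuc ℓ)
  IsFacet V F =
    IsFace V F × ¬ (F ≐ Member V) ×
    (∀ G → IsFace V G → ¬ (G ≐ Member V) → F ⊆ G → G ⊆ F)

  FacetDefining : ∀ {n} → PointConfiguration n → Pred (Linear n) (c ⊔ lsuc ℓ)
  FacetDefining V l = NonNegativeOn V l × IsFacet V (ZeroSet V l)

  AtMostValuesOn : ∀ {n} → PointConfiguration n → ℕ → Pred (Linear n) (c ⊔ ℓ)
  AtMostValuesOn V k l = ∃ λ (rs : List Carrier) →
    length rs ℕ.≤ k × (∀ v → Member V v → Any (⟦ l ⟧ v ≈_) rs)

  IsLevelness : ∀ {n} → PointConfiguration n → Pred ℕ (c ⊔ lsuc ℓ)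
  IsLevelness V = IsSmallest λ k → ∀ l → FacetDefining V l → AtMostValuesOn V k l

  LevelnessAtMost : ∀ {n} → PointConfiguration n → Pred ℕ (c ⊔ lsuc ℓ)
  LevelnessAtMost V k = ∃ λ r → IsLevelness V r × r ℕ.≤ k

  𝟏 : ∀ {n} → Subset n → Point n
  𝟏 B i = if lookup B i then 1# else 0#

  baseConfiguration : ∀ {n} → Matroid n → PointConfiguration n
  baseConfiguration {n} M = record
    { Member  = λ v → ∃ λ B → Matroid.Basis M B × v ≋ 𝟏 B
    ; respect = λ v≋w (B , b , v≋1) → B , b , λ i → trans (sym (v≋w i)) (v≋1 i)
    ; finite  = List.map 𝟏 (subsets n) , λ v (B , _ , v≋1) →
        Anyₚ.map⁺ (Any.map (λ B≡C → subst (λ C → v ≋ 𝟏 C) B≡C v≋1) (∈-subsets B))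
    }

{-# OPTIONS --safe #-}
-- A minor M ∖ e or M / e has as its base configuration a face of V_M, cut out
-- by the linear function x_e or 1 − x_e and identified with a configuration in
-- one dimension less.  So it suffices that Theta rank and levelness do not
-- increase when passing to a face W = V ∩ {g = 0}, where g ≥ 0 on V.
--
-- Theta rank: if l ≥ 0 on W, then l + t g ≥ 0 on V for t large, and a
-- representation of l + t g as a sum of squares on V restricts to one of l on W.
--
-- Levelness: let l define a facet of W.  Among the functions that are
-- nonnegative on V and restrict to a nonzero multiple of l on W, take one with
-- the largest zero set on V; pivoting shows that it defines a facet of V.
module Submission where

open import Defs
open import Algebra.Bundles using (CommutativeMonoid)
open import Axiom.ExcludedMiddle using (ExcludedMiddle)
open import Data.Bool.Base using (if_then_else_; not)
open import Data.Fin.Base as Fin using (Fin; punchIn)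
open import Data.Fin.Subset using (Subset; Side; inside; outside; _∈_; _∉_)
open import Data.List.Base as List using (List; []; _∷_; length; filter)
import Data.List.Extrema as Extrema
open import Data.List.Membership.Propositional using (find) renaming (_∈_ to _∈ᴸ_)
open import Data.List.Membership.Propositional.Properties using (∈-filter⁺; ∈-filter⁻)
open import Data.List.Properties using (length-map; map-∘)
import Data.List.Relation.Binary.Pointwise as Pointwiseᴸ
open import Data.List.Relation.Binary.Sublist.Propositional as Sublist using ()
import Data.List.Relation.Binary.Sublist.Propositional.Properties as Sublistₚ
open import Data.List.Relation.Unary.All as All using (All)
import Data.List.Relation.Unary.All.Properties as Allₚ
open import Data.List.Relation.Unary.Any as Any using (Any)
import Data.List.Relation.Unary.Any.Properties as Anyₚ
open import Data.Nat.Base as ℕ using (ℕ; suc)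
open import Data.Nat.Induction using (<-wellFounded)
import Data.Nat.Properties as ℕₚ
open import Data.Product.Base using (∃; _×_; _,_; proj₁; proj₂; map₂)
open import Data.Sum.Base using (inj₁; inj₂)
open import Data.Vec.Base as Vec using (Vec; _∷_; lookup)
open import Data.Vec.Functional as Vector using (Vector)
import Data.Vec.Functional.Properties as Vectorₚ
import Data.Vec.Properties as Vecₚ
open import Function.Base using (id; _∘_)
open import Function.Bundles using (_⇔_; mk⇔; module Equivalence)
open import Function.Construct.Composition using (_⇔-∘_)
open import Induction.WellFounded using (Acc; acc)
open import Level using (_⊔_)
open import Relation.Binary.Bundles using (TotalOrder)
open import Relation.Binary.PropositionalEquality as ≡ using (_≡_)
import Relation.Binary.Reasoning.Setoid as ≈-Reasoning
open import Relation.Nullary using (¬_; yes; no; contradiction)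
open import Relation.Nullary.Decidable using (decidable-stable)
open import Relation.Unary using (Pred; _⊆_; _≐_)

-- Sublists, and subsets with one coordinate inserted or removed.

sublist-length⇒≡ : ∀ {a} {A : Set a} {xs ys : List A} →
                   xs Sublist.⊆ ys → length ys ℕ.≤ length xs → xs ≡ ys
sublist-length⇒≡ xs⊆ys ≤ = Pointwiseᴸ.Pointwise-≡⇒≡
  (Sublistₚ.to-≋ (ℕₚ.≤-antisym (Sublistₚ.length-mono-≤ xs⊆ys) ≤) xs⊆ys)

insertAt-removeAt-lookup : ∀ {a} {A : Set a} {n} {x} (xs : Vec A (suc n)) i →
                           lookup xs i ≡ x → Vec.insertAt (Vec.removeAt xs i) i x ≡ xs
insertAt-removeAt-lookup xs i ≡.refl = Vecₚ.insertAt-removeAt xs i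

∉⇒lookup : ∀ {n} {e : Fin n} (B : Subset n) → e ∉ B → lookup B e ≡ outside
∉⇒lookup {e = e} B e∉B with lookup B e in eq
... | inside  = contradiction (Vecₚ.lookup⇒[]= e B eq) e∉B
... | outside = ≡.refl

lookup⇒∉ : ∀ {n} {e : Fin n} {B : Subset n} → lookup B e ≡ outside → e ∉ B
lookup⇒∉ eq e∈B with () ← ≡.trans (≡.sym eq) (Vecₚ.[]=⇒lookup e∈B)

-- The common form of deletion and contraction: the bases whose membership of `e` is fixed to be
-- `b`, with that coordinate dropped. Only the choice of `b` depends on the kind of minor and on
-- whether `e` is a loop or coloop.
Section : ∀ {n} → Matroid (suc n) → Fin (suc n) → Side → Pred (Subset n) _
Section M e b B = Matroid.Basis M (Vec.insertAt B e b)

module Classical (em : ∀ {a} → ExcludedMiddle a) where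

  -- Theta rank and levelness are attained minima, so a bound that works must be lowered to the
  -- least one. Excluded middle decides at each stage whether a smaller one remains.
  smallest : ∀ {a} (P : Pred ℕ a) {k} → P k → ∃ λ r → IsSmallest P r × r ℕ.≤ k
  smallest P {k} = go k (<-wellFounded k)
    where
    go : ∀ k → Acc ℕ._<_ k → P k → ∃ λ r → IsSmallest P r × r ℕ.≤ k
    go k (acc rec) p with em {P = ∃ λ j → j ℕ.< k × P j}
    ... | yes (j , j<k , q) =
      let r , s , r≤j = go j (rec j<k) q in r , s , ℕₚ.≤-trans r≤j (ℕₚ.<⇒≤ j<k)
    ... | no ¬q = k , (p , λ j q → ℕₚ.≮⇒≥ λ j<k → ¬q (j , j<k , q)) , ℕₚ.≤-refl

  -- Deletions and contractions as sections.

  module _ {n} (M : Matroid (suc n)) (e : Fin (suc n)) where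

    -- If `e` is not a coloop, the bases avoiding `e` are kept. If it is, every basis contains `e`,
    -- so dropping `e` from all bases is the section at `inside`. Contraction is dual.
    deletion⇒section : ∃ λ b → ∀ B → DeletionBasis M e B ⇔ Section M e b B
    deletion⇒section with em {P = Coloop M e}
    ... | no ¬coloop = outside , λ B → mk⇔
      (λ { (inj₁ (_ , B′ , basis , e∉B′ , ≡.refl)) →
             ≡.subst (Matroid.Basis M)
               (≡.sym (insertAt-removeAt-lookup B′ e (∉⇒lookup B′ e∉B′))) basis
         ; (inj₂ (coloop , _)) → contradiction coloop ¬coloop })
      (λ basis → inj₁ (¬coloop , _ , basis , lookup⇒∉ (Vecₚ.insertAt-lookup B e outside)
                      , Vecₚ.removeAt-insertAt B e outside))
    ... | yes coloop = inside , λ B → mk⇔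
      (λ { (inj₁ (¬coloop , _)) → contradiction coloop ¬coloop
         ; (inj₂ (_ , B′ , basis , ≡.refl)) →
             ≡.subst (Matroid.Basis M)
               (≡.sym (insertAt-removeAt-lookup B′ e (Vecₚ.[]=⇒lookup (coloop B′ basis)))) basis })
      (λ basis → inj₂ (coloop , _ , basis , Vecₚ.removeAt-insertAt B e inside))

    contraction⇒section : ∃ λ b → ∀ B → ContractionBasis M e B ⇔ Section M e b B
    contraction⇒section with em {P = Loop M e}
    ... | no ¬loop = inside , λ B → mk⇔
      (λ { (inj₁ (_ , B′ , basis , e∈B′ , ≡.refl)) →
             ≡.subst (Matroid.Basis M)
               (≡.sym (insertAt-removeAt-lookup B′ e (Vecₚ.[]=⇒lookup e∈B′))) basis
         ; (inj₂ (loop , _)) → contradiction loop ¬loop })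
      (λ basis → inj₁ (¬loop , _ , basis
                      , Vecₚ.lookup⇒[]= e _ (Vecₚ.insertAt-lookup B e inside)
                      , Vecₚ.removeAt-insertAt B e inside))
    ... | yes loop = outside , λ B → mk⇔
      (λ { (inj₁ (¬loop , _)) → contradiction loop ¬loop
         ; (inj₂ (_ , B′ , basis , ≡.refl)) →
             ≡.subst (Matroid.Basis M)
               (≡.sym (insertAt-removeAt-lookup B′ e (∉⇒lookup B′ (loop B′ basis)))) basis })
      (λ basis → inj₂ (loop , _ , basis , Vecₚ.removeAt-insertAt B e outside))

  module Configurations {c ℓ} (ℝ : CompleteOrderedField c ℓ) where

    open CompleteOrderedField ℝ hiding (zero) renaming (reflexive to ≈-reflexive)
    open PointConfigurations ℝ
    open import Algebra.Properties.Ring ring using (-‿distribˡ-*)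
    open import Algebra.Properties.Group +-group using (inverseˡ-unique)
    open import Algebra.Properties.CommutativeSemigroup
      (CommutativeMonoid.commutativeSemigroup +-commutativeMonoid) using (interchange)
    open import Algebra.Properties.CommutativeMonoid.Sum +-commutativeMonoid
      using (sum; sum-remove; sum-cong-≋; ∑-distrib-+; sum-replicate-zero)
    open import Algebra.Properties.CommutativeMonoid.Sum *-commutativeMonoid
      using () renaming (sum to product; sum-remove to product-remove; sum-cong-≋ to product-cong)
    open import Algebra.Properties.CommutativeMonoid.Sum ℕₚ.+-0-commutativeMonoid
      using () renaming (sum-remove to sumℕ-remove)
    open import Algebra.Properties.Semiring.Sum semiring using (*-distribˡ-sum)
    open import Algebra.Properties.Semiring.Exp semiring using (_^_; ^-congˡ)
    open ≈-Reasoning setoid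

    totalOrder : TotalOrder c ℓ ℓ
    totalOrder = record { isTotalOrder = isTotalOrder }

    open TotalOrder totalOrder using (≤-respˡ-≈; ≤-respʳ-≈; reflexive; total)
    open Extrema totalOrder using (argmin; argmin-all; f[argmin]≤f[xs])

    private variable
      m n : ℕ

    -- Order and reciprocals in the field.

    0≤-resp : ∀ {x y} → x ≈ y → 0# ≤ x → 0# ≤ y
    0≤-resp = ≤-respʳ-≈

    ≤⇒0≤- : ∀ {x y} → x ≤ y → 0# ≤ y + - x
    ≤⇒0≤- {x} x≤y = ≤-respˡ-≈ (-‿inverseʳ x) (+-monoˡ-≤ (- x) x≤y)

    0≤1 : 0# ≤ 1#
    0≤1 with total 0# 1#
    ... | inj₁ 0≤1 = 0≤1
    ... | inj₂ 1≤0 = 0≤-resp eq (*-nonNeg 0≤-1 0≤-1)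
      where
      0≤-1 : 0# ≤ - 1#
      0≤-1 = 0≤-resp (+-identityˡ _) (≤⇒0≤- 1≤0)
      eq : - 1# * - 1# ≈ 1#
      eq = begin
        - 1# * - 1#    ≈⟨ -‿distribˡ-* 1# (- 1#) ⟨
        - (1# * - 1#)  ≈⟨ -‿cong (*-identityˡ _) ⟩
        - - 1#         ≈⟨ inverseˡ-unique 1# (- 1#) (-‿inverseʳ 1#) ⟨
        1#             ∎

    -- 0 has the junk reciprocal 0.
    recip : Carrier → Carrier
    recip x with em {P = x ≈ 0#}
    ... | yes _  = 0#
    ... | no x≉0 = proj₁ (inverse x x≉0)

    recip-inverse : ∀ {x} → ¬ x ≈ 0# → x * recip x ≈ 1#
    recip-inverse {x} x≉0 with em {P = x ≈ 0#}
    ... | yes x≈0 = contradiction x≈0 x≉0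
    ... | no x≉0′ = proj₂ (inverse x x≉0′)

    *-recip-cancelˡ : ∀ {x} y → ¬ x ≈ 0# → recip x * (x * y) ≈ y
    *-recip-cancelˡ {x} y x≉0 = begin
      recip x * (x * y)  ≈⟨ *-assoc _ _ _ ⟨
      recip x * x * y    ≈⟨ *-congʳ (trans (*-comm _ _) (recip-inverse x≉0)) ⟩
      1# * y             ≈⟨ *-identityˡ y ⟩
      y                  ∎

    -- Combinations of affine functions.

    ⟦⟧-cong : ∀ (l : Linear n) {v w} → v ≋ w → ⟦ l ⟧ v ≈ ⟦ l ⟧ w
    ⟦⟧-cong (linear a b) v≋w = +-congˡ (sum-cong-≋ λ i → *-congˡ (v≋w i))

    infixl 6 _⊕_⊙_
    _⊕_⊙_ : Linear n → Carrier → Linear n → Linear n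
    linear a b ⊕ t ⊙ linear a′ b′ = linear (a + t * a′) (λ i → b i + t * b′ i)

    ⟦⊕⊙⟧ : ∀ (p : Linear n) t q v → ⟦ p ⊕ t ⊙ q ⟧ v ≈ ⟦ p ⟧ v + t * ⟦ q ⟧ v
    ⟦⊕⊙⟧ (linear a b) t (linear a′ b′) v = begin
      a + t * a′ + sum (λ i → (b i + t * b′ i) * v i)
        ≈⟨ +-congˡ (sum-cong-≋ {x = λ i → (b i + t * b′ i) * v i} λ i →
             trans (distribʳ _ _ _) (+-congˡ (*-assoc _ _ _))) ⟩
      a + t * a′ + sum (λ i → b i * v i + t * (b′ i * v i))
        ≈⟨ +-congˡ (∑-distrib-+ (λ i → b i * v i) _) ⟩
      a + t * a′ + (sum (λ i → b i * v i) + sum (λ i → t * (b′ i * v i)))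
        ≈⟨ +-congˡ (+-congˡ (*-distribˡ-sum t (λ i → b′ i * v i))) ⟨
      a + t * a′ + (sum (λ i → b i * v i) + t * sum (λ i → b′ i * v i))
        ≈⟨ interchange _ _ _ _ ⟩
      a + sum (λ i → b i * v i) + (t * a′ + t * sum (λ i → b′ i * v i))
        ≈⟨ +-congˡ (distribˡ _ _ _) ⟨
      a + sum (λ i → b i * v i) + t * (a′ + sum (λ i → b′ i * v i))
        ∎

    ⟦⊕⊙⟧-zeroʳ : ∀ (p : Linear n) t q {v} → ⟦ q ⟧ v ≈ 0# → ⟦ p ⊕ t ⊙ q ⟧ v ≈ ⟦ p ⟧ v
    ⟦⊕⊙⟧-zeroʳ p t q {v} q≈0 = begin
      ⟦ p ⊕ t ⊙ q ⟧ v        ≈⟨ ⟦⊕⊙⟧ p t q v ⟩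
      ⟦ p ⟧ v + t * ⟦ q ⟧ v  ≈⟨ +-congˡ (trans (*-congˡ q≈0) (zeroʳ t)) ⟩
      ⟦ p ⟧ v + 0#           ≈⟨ +-identityʳ _ ⟩
      ⟦ p ⟧ v                ∎

    -- Supports, zero sets and pivoting.

    NonZeroAt : PointConfiguration n → Linear n → Pred (Point n) _
    NonZeroAt V l v = Member V v × ¬ ⟦ l ⟧ v ≈ 0#

    -- All supports are filtered from one fixed list of representatives, so they are sublists of it
    -- and can be compared by length. That list may contain points outside `V`, hence the membership
    -- test inside `NonZeroAt`.
    support : PointConfiguration n → Linear n → List (Point n)
    support V l = filter (λ v → em {P = NonZeroAt V l v}) (proj₁ (finite V))

    support-sound : ∀ (V : PointConfiguration n) l {v} → v ∈ᴸ support V l → NonZeroAt V l v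
    support-sound V l v∈ =
      proj₂ (∈-filter⁻ (λ v → em {P = NonZeroAt V l v}) {xs = proj₁ (finite V)} v∈)

    support-complete : ∀ (V : PointConfiguration n) l {v} → NonZeroAt V l v →
                       ∃ λ w → w ∈ᴸ support V l × v ≋ w
    support-complete V l (v∈V , lv≉0) =
      let w , w∈ , v≋w = find (proj₂ (finite V) _ v∈V) in
      w , ∈-filter⁺ _ w∈ (respect V v≋w v∈V , λ lw≈0 → lv≉0 (trans (⟦⟧-cong l v≋w) lw≈0)) , v≋w

    support-antitone : ∀ (V : PointConfiguration n) p q → ZeroSet V p ⊆ ZeroSet V q →
                       support V q Sublist.⊆ support V p
    support-antitone V p q p⊆q =
      Sublistₚ.filter⁺ (λ v → em {P = NonZeroAt V q v}) (λ v → em {P = NonZeroAt V p v})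
        (λ { ≡.refl (v∈V , qv≉0) → v∈V , λ pv≈0 → qv≉0 (proj₂ (p⊆q (v∈V , pv≈0))) })
        (Sublist.⊆-refl {x = proj₁ (finite V)})

    -- The inclusion makes the support of `q` a sublist of that of `p`, and the bound on lengths
    -- makes them equal. A zero of `q` that is not a zero of `p` would then have a representative in
    -- the support of `q`.
    ZeroSet-maximal : ∀ (V : PointConfiguration n) p q → ZeroSet V p ⊆ ZeroSet V q →
                      length (support V p) ℕ.≤ length (support V q) →
                      ZeroSet V q ⊆ ZeroSet V p
    ZeroSet-maximal V p q p⊆q p≤q {v} (v∈V , qv≈0) = v∈V , decidable-stable em λ pv≉0 →
      let w , w∈ , v≋w = support-complete V p (v∈V , pv≉0)
          eq = sublist-length⇒≡ (support-antitone V p q p⊆q) p≤q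
          _ , qw≉0 = support-sound V q (≡.subst (w ∈ᴸ_) (≡.sym eq) w∈)
      in qw≉0 (trans (⟦⟧-cong q (λ i → sym (v≋w i))) qv≈0)

    NonZeroAt-exists : ∀ (V : PointConfiguration n) l → ¬ (ZeroSet V l ≐ Member V) → ∃ (NonZeroAt V l)
    NonZeroAt-exists V l ≢V = decidable-stable em λ ∄ →
      ≢V (proj₁ , λ {v} v∈V → v∈V , decidable-stable em λ lv≉0 → ∄ (v , v∈V , lv≉0))

    -- Rotate p about the zero set of q until the next point of V is reached.
    pivot : ∀ (V : PointConfiguration n) p q → NonNegativeOn V q →
            (∀ v → Member V v → ⟦ q ⟧ v ≈ 0# → 0# ≤ ⟦ p ⟧ v) →
            ∃ (NonZeroAt V q) →
            ∃ λ t → NonNegativeOn V (p ⊕ t ⊙ q) ×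
                    ∃ λ v → NonZeroAt V q v × ⟦ p ⊕ t ⊙ q ⟧ v ≈ 0#
    pivot {n} V p q q≥0 p≥0 (u , u≠0) = - r , nonneg , v₀ , v₀≠0 , vanish
      where
      ratio : Point n → Carrier
      ratio v = ⟦ p ⟧ v * recip (⟦ q ⟧ v)

      ratio-* : ∀ {v} → ¬ ⟦ q ⟧ v ≈ 0# → ratio v * ⟦ q ⟧ v ≈ ⟦ p ⟧ v
      ratio-* qv≉0 = trans (*-assoc _ _ _)
        (trans (*-congˡ (trans (*-comm _ _) (recip-inverse qv≉0))) (*-identityʳ _))

      v₀ : Point n
      -- The least ratio p/q is the largest `r` for which p - r q stays nonnegative off the zero set
      -- of `q`. The default `u` may itself be returned; this is harmless, as it is a point of `V`
      -- where `q` is nonzero.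
      v₀ = argmin ratio u (support V q)

      v₀≠0 : NonZeroAt V q v₀
      v₀≠0 = argmin-all ratio u≠0 (All.tabulate (support-sound V q))

      r : Carrier
      r = ratio v₀

      rotate : ∀ v → ¬ ⟦ q ⟧ v ≈ 0# → (ratio v + - r) * ⟦ q ⟧ v ≈ ⟦ p ⊕ - r ⊙ q ⟧ v
      rotate v qv≉0 = trans (distribʳ _ _ _)
        (trans (+-congʳ (ratio-* qv≉0)) (sym (⟦⊕⊙⟧ p (- r) q v)))

      nonneg : NonNegativeOn V (p ⊕ - r ⊙ q)
      nonneg v v∈V with em {P = ⟦ q ⟧ v ≈ 0#}
      ... | yes qv≈0 = 0≤-resp (sym (⟦⊕⊙⟧-zeroʳ p (- r) q qv≈0)) (p≥0 v v∈V qv≈0)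
      ... | no  qv≉0 =
        -- Minimality of `r` is known only at listed points, so the inequality is proved at a
        -- representative `w` and carried back to `v`.
        let w , w∈ , v≋w = support-complete V q (v∈V , qv≉0)
            w∈V , qw≉0   = support-sound V q w∈
            r≤           = All.lookup (f[argmin]≤f[xs] {f = ratio} u (support V q)) w∈
        in 0≤-resp (trans (rotate w qw≉0) (⟦⟧-cong (p ⊕ - r ⊙ q) (λ i → sym (v≋w i))))
             (*-nonNeg (≤⇒0≤- r≤) (q≥0 w w∈V))

      vanish : ⟦ p ⊕ - r ⊙ q ⟧ v₀ ≈ 0#
      vanish = trans (sym (rotate v₀ (proj₂ v₀≠0))) (trans (*-congʳ (-‿inverseʳ r)) (zeroˡ _))

    -- Pivoting `p` about `l` gives h = p + t l, nonnegative on `W`, zero on the facet and also at a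
    -- point `w₀` off it. Since a facet is a maximal proper face, `h` vanishes on all of `W`, and so
    -- p = -t l there.
    facet-multiple : ∀ (W : PointConfiguration n) l p → FacetDefining W l → NonNegativeOn W p →
                     ZeroSet W l ⊆ ZeroSet W p →
                     ∃ λ s → ∀ w → Member W w → ⟦ p ⟧ w ≈ s * ⟦ l ⟧ w
    facet-multiple W l p (l≥0 , _ , F≢W , F-max) p≥0 F⊆p
      with t , h≥0 , w₀ , (w₀∈W , lw₀≉0) , hw₀≈0 ←
        pivot W p l l≥0 (λ w w∈W _ → p≥0 w w∈W) (NonZeroAt-exists W l F≢W)
      with em {P = ZeroSet W (p ⊕ t ⊙ l) ≐ Member W}
    ... | yes (_ , W⊆h) = - t , λ w w∈W →
      trans (inverseˡ-unique _ _ (trans (sym (⟦⊕⊙⟧ p t l w)) (proj₂ (W⊆h w∈W))))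
            (-‿distribˡ-* t (⟦ l ⟧ w))
    ... | no h≢W = contradiction
      (proj₂ (F-max _ (p ⊕ t ⊙ l , h≥0 , id , id) h≢W
        (λ { f@(w∈W , lw≈0) → w∈W , trans (⟦⊕⊙⟧-zeroʳ p t l lw≈0) (proj₂ (F⊆p f)) })
        (w₀∈W , hw₀≈0)))
      lw₀≉0

    -- Embeddings onto faces.

    -- That `embed` is affine is encoded by `restrict` and `pullback`.
    record FaceEmbedding (W : PointConfiguration m) (V : PointConfiguration n) : Set (c ⊔ ℓ) where
      field
        embed             : Point m → Point n
        embed-∈           : ∀ {w} → Member W w → Member V (embed w)
        supporting        : Linear n
        supporting-≥0     : NonNegativeOn V supporting
        supporting-embed  : ∀ {w} → Member W w → ⟦ supporting ⟧ (embed w) ≈ 0#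
        supporting-zero   : ∀ {v} → Member V v → ⟦ supporting ⟧ v ≈ 0# →
                            ∃ λ w → Member W w × v ≋ embed w
        restrict          : Linear n → Linear m
        restrict-eval     : ∀ l w → ⟦ restrict l ⟧ w ≈ ⟦ l ⟧ (embed w)
        extend            : Linear m → Linear n
        extend-eval       : ∀ l w → ⟦ extend l ⟧ (embed w) ≈ ⟦ l ⟧ w
        pullback          : Term n → Term m
        pullback-degree   : ∀ t → Term.degree (pullback t) ℕ.≤ Term.degree t
        pullback-eval     : ∀ t w → Term.evaluate (pullback t) w ≈ Term.evaluate t (embed w)

    sumᴸ-map-cong : ∀ {a} {A : Set a} {f g : A → Carrier} → (∀ x → f x ≈ g x) → ∀ xs →
                    sumᴸ (List.map f xs) ≈ sumᴸ (List.map g xs)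
    sumᴸ-map-cong f≈g []       = refl
    sumᴸ-map-cong f≈g (x ∷ xs) = +-cong (f≈g x) (sumᴸ-map-cong f≈g xs)

    -- Theta rank and levelness of a face.

    module _ {W : PointConfiguration m} {V : PointConfiguration n} (φ : FaceEmbedding W V) where
      open FaceEmbedding φ

      NonNegativeOn-restrict : ∀ p → NonNegativeOn V p → NonNegativeOn W (restrict p)
      NonNegativeOn-restrict p p≥0 w w∈W = 0≤-resp (sym (restrict-eval p w)) (p≥0 _ (embed-∈ w∈W))

      -- On the face, `extend l` agrees with `l` and is nonnegative. `pivot` finds a multiple of
      -- `supporting` whose addition makes it nonnegative on `V`, and the addition changes nothing
      -- on the face.
      extend-≥0 : ∀ l → NonNegativeOn W l →
                  ∃ λ l̂ → NonNegativeOn V l̂ × ∀ w → Member W w → ⟦ l̂ ⟧ (embed w) ≈ ⟦ l ⟧ w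
      extend-≥0 l l≥0 with em {P = ∃ (NonZeroAt V supporting)}
      ... | yes ∃≠0 =
        let t , ≥0 , _ = pivot V (extend l) supporting supporting-≥0 face-≥0 ∃≠0 in
        extend l ⊕ t ⊙ supporting , ≥0 , λ w w∈W →
          trans (⟦⊕⊙⟧-zeroʳ (extend l) t supporting (supporting-embed w∈W)) (extend-eval l w)
        where
        face-≥0 : ∀ v → Member V v → ⟦ supporting ⟧ v ≈ 0# → 0# ≤ ⟦ extend l ⟧ v
        face-≥0 v v∈V gv≈0 =
          let w , w∈W , v≋w = supporting-zero v∈V gv≈0 in
          0≤-resp (sym (trans (⟦⟧-cong (extend l) v≋w) (extend-eval l w))) (l≥0 w w∈W)
      -- The face is all of `V`: there is no point off it to pivot to, and no correction to make.
      ... | no ∄≠0 = extend l ,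
        (λ v v∈V →
          let gv≈0 = decidable-stable em λ gv≉0 → ∄≠0 (v , v∈V , gv≉0)
              w , w∈W , v≋w = supporting-zero v∈V gv≈0
          in 0≤-resp (sym (trans (⟦⟧-cong (extend l) v≋w) (extend-eval l w))) (l≥0 w w∈W)) ,
        λ w _ → extend-eval l w

      pullback-evaluate : ∀ h w → evaluate (List.map pullback h) w ≈ evaluate h (embed w)
      pullback-evaluate []      w = refl
      pullback-evaluate (t ∷ h) w = +-cong (pullback-eval t w) (pullback-evaluate h w)

      -- Squares pull back to squares, and substituting the embedding term by term does not raise
      -- degrees.
      sos-restrict : ∀ {k l l̂} → IsSOS V k l̂ →
                     (∀ w → Member W w → ⟦ l̂ ⟧ (embed w) ≈ ⟦ l ⟧ w) → IsSOS W k l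
      sos-restrict {l = l} {l̂} (hs , deg , eq) l̂≈l =
        List.map (List.map pullback) hs ,
        Allₚ.map⁺ (All.map (Allₚ.map⁺ ∘ All.map λ {t} → ℕₚ.≤-trans (pullback-degree t)) deg) ,
        λ w w∈W → begin
          ⟦ l ⟧ w
            ≈⟨ l̂≈l w w∈W ⟨
          ⟦ l̂ ⟧ (embed w)
            ≈⟨ eq (embed w) (embed-∈ w∈W) ⟩
          sumᴸ (List.map (λ h → evaluate h (embed w) ^ 2) hs)
            ≈⟨ sumᴸ-map-cong (λ h → ^-congˡ 2 (pullback-evaluate h w)) hs ⟨
          sumᴸ (List.map (λ h → evaluate (List.map pullback h) w ^ 2) hs)
            ≡⟨ ≡.cong sumᴸ (map-∘ hs) ⟩
          sumᴸ (List.map (λ h → evaluate h w ^ 2) (List.map (List.map pullback) hs))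
            ∎

      ThetaRankAtMost-face : ∀ {k} → ThetaRankAtMost V k → ThetaRankAtMost W k
      ThetaRankAtMost-face (r , (sos , _) , r≤k) =
        map₂ (map₂ λ ≤r → ℕₚ.≤-trans ≤r r≤k)
          (smallest (λ k → ∀ l → NonNegativeOn W l → IsSOS W k l) λ l l≥0 →
            let l̂ , l̂≥0 , l̂≈l = extend-≥0 l l≥0 in sos-restrict {l = l} {l̂} (sos l̂ l̂≥0) l̂≈l)

      -- Multiples of `l` are allowed because a function on `V` vanishing on the relevant zeros is
      -- known, by `facet-multiple`, only to restrict to some multiple of `l`. A nonzero factor
      -- keeps the zero set on `W` equal to that of `l`.
      ExtendsMultiple : Linear m → Pred (Linear n) _
      ExtendsMultiple l p = NonNegativeOn V p ×
        ∃ λ s → ¬ s ≈ 0# × ∀ w → Member W w → ⟦ p ⟧ (embed w) ≈ s * ⟦ l ⟧ w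

      extend-minimal : ∀ l → NonNegativeOn W l →
        ∃ λ p → ExtendsMultiple l p ×
                (∀ q → ExtendsMultiple l q → length (support V p) ℕ.≤ length (support V q))
      extend-minimal l l≥0
        with l̂ , l̂≥0 , l̂≈l ← extend-≥0 l l≥0
        with _ , ((p , p-ext , ≡.refl) , min) , _ ←
          smallest (λ k → ∃ λ p → ExtendsMultiple l p × length (support V p) ≡ k)
            -- The nonnegative extension, with factor 1, shows that there is a candidate to start
            -- from.
            (l̂ , (l̂≥0 , 1# , 0≉1 ∘ sym , λ w w∈W → trans (l̂≈l w w∈W) (sym (*-identityˡ _))) , ≡.refl)
        = p , p-ext , λ q q-ext → min _ (q , q-ext , ≡.refl)

      extend-facet : ∀ l → FacetDefining W l → ∃ λ p → ExtendsMultiple l p × FacetDefining V p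
      extend-facet l facet@(l≥0 , _ , F≢W , _)
        with p , ext@(p≥0 , s , s≉0 , p≈sl) , min ← extend-minimal l l≥0
        with w₀ , w₀∈W , lw₀≉0 ← NonZeroAt-exists W l F≢W
        = p , ext , p≥0 , (p , p≥0 , id , id) , p≢V , p-max
        where
        p≈0⇒l≈0 : ∀ {w} → Member W w → ⟦ p ⟧ (embed w) ≈ 0# → ⟦ l ⟧ w ≈ 0#
        p≈0⇒l≈0 {w} w∈W pw≈0 = begin
          ⟦ l ⟧ w                  ≈⟨ *-recip-cancelˡ _ s≉0 ⟨
          recip s * (s * ⟦ l ⟧ w)  ≈⟨ *-congˡ (trans (sym (p≈sl w w∈W)) pw≈0) ⟩
          recip s * 0#             ≈⟨ zeroʳ _ ⟩
          0#                       ∎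

        p≢V : ¬ (ZeroSet V p ≐ Member V)
        p≢V (_ , V⊆p) = lw₀≉0 (p≈0⇒l≈0 w₀∈W (proj₂ (V⊆p (embed-∈ w₀∈W))))

        zeros : ∀ q → ZeroSet V p ⊆ ZeroSet V q → ZeroSet W l ⊆ ZeroSet W (restrict q)
        zeros q p⊆q {w} (w∈W , lw≈0) = w∈W , trans (restrict-eval q w) (proj₂ (p⊆q
          (embed-∈ w∈W , trans (p≈sl w w∈W) (trans (*-congˡ lw≈0) (zeroʳ s)))))

        maximal : ∀ q → NonNegativeOn V q → ¬ (ZeroSet V q ≐ Member V) →
                  ZeroSet V p ⊆ ZeroSet V q → ZeroSet V q ⊆ ZeroSet V p
        maximal q q≥0 q≢V p⊆q
          with s′ , q≈s′l ← facet-multiple W l (restrict q) facet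
                              (NonNegativeOn-restrict q q≥0) (zeros q p⊆q)
          with em {P = s′ ≈ 0#}
        -- Here `q` itself extends a nonzero multiple of `l`, so its support is no shorter than that
        -- of `p`.
        ... | no s′≉0 = ZeroSet-maximal V p q p⊆q
          (min q (q≥0 , s′ , s′≉0 , λ w w∈W → trans (sym (restrict-eval q w)) (q≈s′l w w∈W)))
        -- Now `q` vanishes on `W`, so p + t q still extends the multiple `s` of `l`. It vanishes
        -- wherever `p` does and also at a point `v` with q(v) ≠ 0, where `p` cannot vanish; this
        -- contradicts the minimal support of `p`.
        ... | yes s′≈0
          with t , h≥0 , v , (v∈V , qv≉0) , hv≈0 ←
            pivot V p q q≥0 (λ v v∈V _ → p≥0 v v∈V) (NonZeroAt-exists V q q≢V)
          = contradiction
              (proj₂ (p⊆q (ZeroSet-maximal V p (p ⊕ t ⊙ q) p⊆h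
                (min (p ⊕ t ⊙ q) (h≥0 , s , s≉0 , λ w w∈W →
                  trans (⟦⊕⊙⟧-zeroʳ p t q (q-embed≈0 w∈W)) (p≈sl w w∈W)))
                (v∈V , hv≈0))))
              qv≉0
          where
          q-embed≈0 : ∀ {w} → Member W w → ⟦ q ⟧ (embed w) ≈ 0#
          q-embed≈0 {w} w∈W = trans (sym (restrict-eval q w))
            (trans (q≈s′l w w∈W) (trans (*-congʳ s′≈0) (zeroˡ _)))
          p⊆h : ZeroSet V p ⊆ ZeroSet V (p ⊕ t ⊙ q)
          p⊆h z@(v∈V , pv≈0) = v∈V , trans (⟦⊕⊙⟧-zeroʳ p t q (proj₂ (p⊆q z))) pv≈0

        p-max : ∀ G → IsFace V G → ¬ (G ≐ Member V) → ZeroSet V p ⊆ G → G ⊆ ZeroSet V p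
        p-max G (q , q≥0 , G⊆q , q⊆G) G≢V p⊆G =
          maximal q q≥0 (λ (_ , V⊆q) → G≢V (proj₁ ∘ G⊆q , q⊆G ∘ V⊆q)) (G⊆q ∘ p⊆G) ∘ G⊆q

      LevelnessAtMost-face : ∀ {k} → LevelnessAtMost V k → LevelnessAtMost W k
      LevelnessAtMost-face (r , (level , _) , r≤k) =
        map₂ (map₂ λ ≤r → ℕₚ.≤-trans ≤r r≤k)
          (smallest (λ k → ∀ l → FacetDefining W l → AtMostValuesOn W k l) λ l facet →
            let p , (_ , s , s≉0 , p≈sl) , p-facet = extend-facet l facet
                rs , length≤ , values = level p p-facet
            -- On `W` the function `l` is `recip s` times `p`, so its values are rescaled values of
            -- `p` on `V`.
            in List.map (recip s *_) rs ,
               ≡.subst (ℕ._≤ r) (≡.sym (length-map _ rs)) length≤ ,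
               λ w w∈W → Anyₚ.map⁺ (Any.map
                 (λ p≈x → trans (sym (*-recip-cancelˡ _ s≉0))
                                (*-congˡ (trans (sym (p≈sl w w∈W)) p≈x)))
                 (values (embed w) (embed-∈ w∈W))))

    -- Base configurations of minors as faces.

    sum-0* : ∀ (v : Point n) → sum (λ i → 0# * v i) ≈ 0#
    sum-0* {n} v = trans (sum-cong-≋ λ i → zeroˡ (v i)) (sum-replicate-zero n)

    -- The improper face, cut out by the zero function. It handles matroids that have the same bases
    -- without being identical.
    equal-embedding : ∀ {V W : PointConfiguration n} → Member W ≐ Member V → FaceEmbedding W V
    equal-embedding {n} (W⊆V , V⊆W) = record
      { embed            = id
      ; embed-∈          = W⊆V
      ; supporting       = linear 0# λ _ → 0#
      ; supporting-≥0    = λ v _ → reflexive (sym (eval≈0 v))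
      ; supporting-embed = λ _ → eval≈0 _
      ; supporting-zero  = λ v∈V _ → _ , V⊆W v∈V , λ _ → refl
      ; restrict         = id
      ; restrict-eval    = λ _ _ → refl
      ; extend           = id
      ; extend-eval      = λ _ _ → refl
      ; pullback         = id
      ; pullback-degree  = λ _ → ℕₚ.≤-refl
      ; pullback-eval    = λ _ _ → refl
      }
      where
      eval≈0 : ∀ v → ⟦ linear {n} 0# (λ _ → 0#) ⟧ v ≈ 0#
      eval≈0 v = trans (+-identityˡ _) (sum-0* v)

    -- For x in {0, 1}, the expression `bit b + sign b * x` is 0 if x is `bit b` and 1 otherwise.
    bit sign : Side → Carrier
    bit b = if b then 1# else 0#
    sign b = if b then - 1# else 1#

    -- x_e for b = outside, and 1 − x_e for b = inside
    coordinate : Fin (suc n) → Side → Linear (suc n)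
    coordinate e b = linear (bit b) (Vector.insertAt (λ _ → 0#) e (sign b))

    sum-insertAt : ∀ (b : Vector Carrier n) e x (v : Point (suc n)) →
                   sum (λ i → Vector.insertAt b e x i * v i) ≈ x * v e + sum (λ i → b i * v (punchIn e i))
    sum-insertAt b e x v = trans (sum-remove {i = e} (λ i → Vector.insertAt b e x i * v i))
      (+-cong (*-congʳ (≈-reflexive (Vectorₚ.insertAt-lookup b e x)))
              (sum-cong-≋ λ i → *-congʳ (≈-reflexive (Vectorₚ.insertAt-punchIn b e x i))))

    coordinate-eval : ∀ (e : Fin (suc n)) b v → ⟦ coordinate e b ⟧ v ≈ bit b + sign b * v e
    coordinate-eval {n} e b v = +-congˡ (begin
      sum (λ i → Vector.insertAt (λ _ → 0#) e (sign b) i * v i)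
        ≈⟨ sum-insertAt (λ _ → 0#) e (sign b) v ⟩
      sign b * v e + sum (λ i → 0# * v (punchIn e i))
        ≈⟨ +-congˡ (sum-0* (v ∘ punchIn e)) ⟩
      sign b * v e + 0#
        ≈⟨ +-identityʳ _ ⟩
      sign b * v e
        ∎)

    bit-same : ∀ b → bit b + sign b * bit b ≈ 0#
    bit-same inside  = trans (+-congˡ (*-identityʳ _)) (-‿inverseʳ 1#)
    bit-same outside = trans (+-identityˡ _) (zeroʳ 1#)

    bit-flip : ∀ b → bit b + sign b * bit (not b) ≈ 1#
    bit-flip inside  = trans (+-congˡ (zeroʳ _)) (+-identityʳ 1#)
    bit-flip outside = trans (+-identityˡ _) (*-identityˡ 1#)

    bit-≥0 : ∀ b b′ → 0# ≤ bit b + sign b * bit b′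
    bit-≥0 inside  inside  = reflexive (sym (bit-same inside))
    bit-≥0 inside  outside = 0≤-resp (sym (bit-flip inside)) 0≤1
    bit-≥0 outside inside  = 0≤-resp (sym (bit-flip outside)) 0≤1
    bit-≥0 outside outside = reflexive (sym (bit-same outside))

    bit-zero : ∀ b b′ → bit b + sign b * bit b′ ≈ 0# → b′ ≡ b
    bit-zero inside  inside  _  = ≡.refl
    bit-zero inside  outside ≈0 = contradiction (trans (sym ≈0) (bit-flip inside)) 0≉1
    bit-zero outside inside  ≈0 = contradiction (trans (sym ≈0) (bit-flip outside)) 0≉1
    bit-zero outside outside _  = ≡.refl

    𝟏-insertAt : ∀ (B : Subset n) e b i →
                 Vector.insertAt (𝟏 B) e (bit b) i ≡ 𝟏 (Vec.insertAt B e b) i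
    𝟏-insertAt B       Fin.zero    b Fin.zero    = ≡.refl
    𝟏-insertAt B       Fin.zero    b (Fin.suc i) = ≡.refl
    𝟏-insertAt (_ ∷ B) (Fin.suc e) b Fin.zero    = ≡.refl
    𝟏-insertAt (_ ∷ B) (Fin.suc e) b (Fin.suc i) = 𝟏-insertAt B e b i

    insertAt-cong : ∀ {v w : Point n} e x → v ≋ w → Vector.insertAt v e x ≋ Vector.insertAt w e x
    insertAt-cong             Fin.zero    x v≋w Fin.zero    = refl
    insertAt-cong             Fin.zero    x v≋w (Fin.suc i) = v≋w i
    insertAt-cong {n = suc n} (Fin.suc e) x v≋w Fin.zero    = v≋w Fin.zero
    insertAt-cong {n = suc n} (Fin.suc e) x v≋w (Fin.suc i) = insertAt-cong e x (v≋w ∘ Fin.suc) i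

    -- The embedding inserts the constant `bit b` at `e`. The function `coordinate e b` is 0 or 1 on
    -- indicator vectors, and it is 0 exactly for the bases whose side at `e` is `b`, which are the
    -- bases of `N`.
    section-embedding : ∀ {N : Matroid n} {M : Matroid (suc n)} e b → N HasBases Section M e b →
                        FaceEmbedding (baseConfiguration N) (baseConfiguration M)
    section-embedding {n} {N} {M} e b N⇔M = record
      { embed            = embed
      ; embed-∈          = λ (B , basis , w≋B) → Vec.insertAt B e b , Equivalence.to (N⇔M B) basis ,
          λ i → trans (insertAt-cong e (bit b) w≋B i) (≈-reflexive (𝟏-insertAt B e b i))
      ; supporting       = coordinate e b
      ; supporting-≥0    = λ v (B , _ , v≋B) →
          0≤-resp (sym (coordinate-𝟏 B v v≋B)) (bit-≥0 b (lookup B e))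
      ; supporting-embed = λ {w} _ → trans (coordinate-eval e b (embed w))
          (trans (+-congˡ (*-congˡ (≈-reflexive (Vectorₚ.insertAt-lookup w e (bit b))))) (bit-same b))
      ; supporting-zero  = λ {v} (B , basis , v≋B) ≈0 →
          let B≡ = insertAt-removeAt-lookup B e
                     (bit-zero b (lookup B e) (trans (sym (coordinate-𝟏 B v v≋B)) ≈0))
              B′ = Vec.removeAt B e
          in 𝟏 B′ ,
             (B′ , Equivalence.from (N⇔M B′) (≡.subst (Matroid.Basis M) (≡.sym B≡) basis) , λ _ → refl) ,
             λ i → trans (v≋B i) (≈-reflexive
               (≡.trans (≡.cong (λ C → 𝟏 C i) (≡.sym B≡)) (≡.sym (𝟏-insertAt B′ e b i))))
      -- Substituting `bit b` for x_e moves the slope at `e` into the constant.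
      ; restrict         = λ (linear a c) → linear (a + c e * bit b) (Vector.removeAt c e)
      ; restrict-eval    = λ (linear a c) w → trans (+-assoc _ _ _) (+-congˡ (sym
          (trans (sum-remove {i = e} (λ i → c i * embed w i)) (+-cong
            (*-congˡ (≈-reflexive (Vectorₚ.insertAt-lookup w e (bit b))))
            (sum-cong-≋ λ i → *-congˡ (≈-reflexive (Vectorₚ.insertAt-punchIn w e (bit b) i)))))))
      ; extend           = λ (linear a c) → linear a (Vector.insertAt c e 0#)
      ; extend-eval      = λ (linear a c) w → +-congˡ (begin
          sum (λ i → Vector.insertAt c e 0# i * embed w i)
            ≈⟨ sum-insertAt c e 0# (embed w) ⟩
          0# * embed w e + sum (λ i → c i * embed w (punchIn e i))
            ≈⟨ trans (+-congʳ (zeroˡ _)) (+-identityˡ _) ⟩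
          sum (λ i → c i * embed w (punchIn e i))
            ≈⟨ sum-cong-≋ (λ i → *-congˡ (≈-reflexive (Vectorₚ.insertAt-punchIn w e (bit b) i))) ⟩
          sum (λ i → c i * w i)
            ∎)
      -- The power of x_e becomes a scalar, so the degree drops by `α e`.
      ; pullback         = λ (term a α) → term (a * bit b ^ α e) (Vector.removeAt α e)
      ; pullback-degree  = λ (term a α) → ℕₚ.≤-trans (ℕₚ.m≤n+m _ (α e))
                                            (ℕₚ.≤-reflexive (≡.sym (sumℕ-remove {i = e} α)))
      ; pullback-eval    = λ (term a α) w → trans (*-assoc _ _ _) (*-congˡ (sym
          (trans (product-remove {i = e} (λ i → embed w i ^ α i)) (*-cong
            (^-congˡ (α e) (≈-reflexive (Vectorₚ.insertAt-lookup w e (bit b))))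
            (product-cong λ i → ^-congˡ (α (punchIn e i))
              (≈-reflexive (Vectorₚ.insertAt-punchIn w e (bit b) i)))))))
      }
      where
      embed : Point n → Point (suc n)
      embed w = Vector.insertAt w e (bit b)

      coordinate-𝟏 : ∀ B v → v ≋ 𝟏 B → ⟦ coordinate e b ⟧ v ≈ bit b + sign b * bit (lookup B e)
      coordinate-𝟏 B v v≋B = trans (coordinate-eval e b v) (+-congˡ (*-congˡ (v≋B e)))

    -- Each deletion or contraction is a single face embedding, so whatever is inherited by faces
    -- descends along the whole sequence. Leaving `P` abstract lets one induction serve both
    -- invariants.
    minor-induction : ∀ {p} (P : ∀ {n} → PointConfiguration n → Set p) →
      (∀ {m n} {W : PointConfiguration m} {V : PointConfiguration n} → FaceEmbedding W V → P V → P W) →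
      ∀ {M : Matroid n} {N : Matroid m} → N IsMinorOf M → P (baseConfiguration M) → P (baseConfiguration N)
    minor-induction P face (equal N⇔M) = face (equal-embedding
      ( (λ (B , basis , v≋B) → B , Equivalence.to (N⇔M B) basis , v≋B)
      , (λ (B , basis , v≋B) → B , Equivalence.from (N⇔M B) basis , v≋B)))
    minor-induction P face (deletion {M = M} {M′} e M′⇔ N≤M′) =
      let b , sec = deletion⇒section M e in
      minor-induction P face N≤M′ ∘
        face (section-embedding {N = M′} {M} e b λ B → sec B ⇔-∘ M′⇔ B)
    minor-induction P face (contraction {M = M} {M′} e M′⇔ N≤M′) =
      let b , sec = contraction⇒section M e in
      minor-induction P face N≤M′ ∘
        face (section-embedding {N = M′} {M} e b λ B → sec B ⇔-∘ M′⇔ B)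

theorem2p11 : (∀ {a} → ExcludedMiddle a) →
    ∀ {c ℓ} (ℝ : CompleteOrderedField c ℓ) →
    let open PointConfigurations ℝ in
    (k : ℕ) {n : ℕ} (M : Matroid n) →
    (ThetaRankAtMost (baseConfiguration M) k →
    ∀ {m} (N : Matroid m) → N IsMinorOf M → ThetaRankAtMost (baseConfiguration N) k)
    ×
    (LevelnessAtMost (baseConfiguration M) k →
    ∀ {m} (N : Matroid m) → N IsMinorOf M → LevelnessAtMost (baseConfiguration N) k)
theorem2p11 em ℝ k M =
    (λ theta N N≤M → minor-induction (λ V → ThetaRankAtMost V k) (λ φ → ThetaRankAtMost-face φ) N≤M theta)
  , (λ level N N≤M → minor-induction (λ V → LevelnessAtMost V k) (λ φ → LevelnessAtMost-face φ) N≤M level)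
  where
  open PointConfigurations ℝ
  open Classical em
  open Configurations ℝ
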